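{- The algorithm $\textsc{SolveWeakSCC}(V,F,\mathrm{SCCs})$ (defined in the context) solves weak games with $n$ nodes in symbolic time $\mathcal{O}(n)$ and yields memoryless winning strategies for the system player. That is, on every weak game $((V,E),F)$ with $|V|=n$, the algorithm terminates after $\mathcal{O}(n)$ symbolic operations, returns exactly the set of nodes won by the system player, and yields a memoryless system strategy that wins from every node of this set.
   Context: **Games.** A game arena is a finite directed graph $A=(V,E)$ in which every node has a successor, with $V$ partitioned into system nodes $V_s$ and environment nodes $V_e$; $E(v)$ is the set of successors of $v$. A memoryless system strategy is a map $\sigma:V_s\to V$ with $\sigma(v)\in E(v)$. In a Büchi game $(A,F)$, $F\subseteq V$, the system player wins an infinite play iff it visits $F$ infinitely often. A strategy wins node $v$ if all plays from $v$ compatible with it are won by its owner; every node is won by exactly one player. **Weak games.** A deterministic weak automaton (DWA) $(T,F_T)$ consists of a deterministic transition system $T=(2^{AP},Q,\iota,\delta)$ ($AP$ finite, $Q$ finite, $\delta:Q\times 2^{AP}\to Q$) and $F_T\subseteq Q$ such that every strongly connected component (SCC: maximal set of mutually reachable states) is contained in or disjoint from $F_T$. With $AP=X\uplus Y$, it induces the arena with nodes $Q\cup(Q\times 2^X)\cup(Q\times 2^X\times 2^Y)$, $V_s=Q$, all other nodes in $V_e$, and edges $q\to(q,x)$, $(q,x)\to(q,x,y)$, $(q,x,y)\to\delta(q,x\cup y)$ for all $x\subseteq X,y\subseteq Y$. A weak game (DWA game) is a Büchi game $(A,F)$ induced in this way by a DWA, where a node belongs to $F$ iff its $Q$-component is in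 $F_T$. Hence every SCC of $A$ is contained in $F$ or disjoint from $F$. **Symbolic operations.** For $W\subseteq V$ put $\Diamond W=\{v\mid E(v)\cap W\ne\emptyset\}$, $\Box W=\{v\mid E(v)\subseteq W\}$, and $\mathsf{CPre}_s(W)=(V_s\cap\Diamond W)\cup(V_e\cap\Box W)$. Symbolic time counts the number of set operations (union, intersection, complement) on subsets of $V$; evaluating $\mathsf{CPre}_s$ costs $\mathcal{O}(1)$. Define, with $\mu$ and $\nu$ denoting least and greatest fixpoints over $2^V$, $$\mathrm{Reach}(W,T)=\mu Z.\,T\cup(W\cap\mathsf{CPre}_s(Z)),\qquad \mathrm{Safe}(W,T)=\nu Z.\,T\cup(W\cap\mathsf{CPre}_s(Z)).$$ Both are computed by fixpoint iteration, in symbolic time $\mathcal{O}(|W|)$. **Algorithm $\textsc{SolveWeakSCC}(V,F,\mathrm{SCCs})$.** Input: a weak game together with the set $\mathrm{SCCs}$ of all SCCs of its arena (the SCC decomposition of a graph with $n$ vertices is known to be computable in symbolic time $\mathcal{O}(n)$). The algorithm uses a function $\mathrm{bottomSCCs}$ returning those SCCs in a given set of SCCs that are minimal with respect to reachability (i.e. from which no other SCC of the set is reachable). Initialize $W=\emptyset$. While $\mathrm{SCCs}\neq\emptyset$: let $B=\mathrm{bottomSCCs}(\mathrm{SCCs})$ and set $\mathrm{SCCs}=\mathrm{SCCs}\setminus B$; for each $S\in B$, let $Z=\mathrm{Safe}(S,W)$ if $S\subseteq F$ and $Z=\mathrm{Reach}(S,W)$ otherwise (i.e. if $S\cap F=\emptyset$),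 and set $W=W\cup Z$. Return $W$. -}

module Defs where

open import Data.Bool using (Bool; true; false; if_then_else_)
open import Data.Bool.Properties using () renaming (_≟_ to _≟ᵇ_)
open import Data.Empty using (⊥-elim)
open import Data.Fin using (Fin)
import Data.Fin.Properties as Fin
open import Data.Fin.Subset
  using (Subset; _∈_; _⊆_; _∪_; _∩_; ∁; ⊥; ⊤; Nonempty; Empty)
open import Data.Fin.Subset.Properties
  using (_∈?_; _⊆?_; nonempty?; ⊆-min; ⊆-max
        ; x∈p∩q⁺; x∈p∩q⁻; x∈p∪q⁺; x∈p∪q⁻)
open import Data.List using (List; []; _∷_; allFin; applyUpTo; filter; length)
import Data.List.Membership.DecPropositional as DecMembership
open import Data.List.Membership.Propositional using () renaming (_∈_ to _∈ˡ_)
open import Data.List.Membership.Propositional.Properties using (∈-allFin)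
open import Data.List.Relation.Unary.All as All using (All)
open import Data.List.Relation.Unary.Any using (here; there)
open import Data.Nat using (ℕ; suc; _+_; _*_; _≤_)
open import Data.Product using (Σ-syntax; ∃-syntax; _×_; _,_; proj₁; proj₂)
open import Data.Sum as Sum using (_⊎_; inj₁; inj₂)
open import Data.Vec using (_++_; tabulate)
open import Data.Vec.Properties using (≡-dec; []=⇒lookup; lookup⇒[]=; lookup∘tabulate)
open import Function using (_∘_)
open import Function.Bundles using (_↔_; _⇔_; Inverse)
open import Level using (0ℓ)
open import Relation.Binary using (Rel; Decidable; DecidableEquality)
open import Relation.Binary.Construct.Closure.ReflexiveTransitive
  using (Star; ε; _◅_; _◅◅_)
open import Relation.Binary.PropositionalEquality
  using (_≡_; refl; sym; trans; cong; subst)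
open import Relation.Nullary using (Dec; yes; no; does)
open import Relation.Nullary.Decidable using (map′; _×-dec_; _⊎-dec_; _→-dec_; ¬?)
open import Relation.Unary using () renaming (Decidable to Decidable₁)

private
  variable
    n : ℕ
    A B : Set

module _ {n : ℕ} (_⟶_ : Rel (Fin n) 0ℓ) where

  MutuallyReachable : Subset n → Set
  MutuallyReachable S = ∀ {u v} → u ∈ S → v ∈ S → Star _⟶_ u v

  IsSCC : Subset n → Set
  IsSCC S = MutuallyReachable S
          × (∀ S′ → MutuallyReachable S′ → S ⊆ S′ → S′ ⊆ S)

  Reaches : Subset n → Subset n → Set
  Reaches S S′ = ∃[ u ] ∃[ v ] u ∈ S × v ∈ S′ × Star _⟶_ u v

  -- No member of L other than S itself is reachable from S.
  Bottom : List (Subset n) → Subset n → Set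
  Bottom L S = All (λ S′ → Reaches S S′ → S′ ≡ S) L

_≟ˢ_ : DecidableEquality (Subset n)
_≟ˢ_ = ≡-dec _≟ᵇ_

-- Reachability in a finite graph is decidable: `Via xs u v` says that v
-- is reached from u by a path with intermediate nodes in xs.
module _ {n : ℕ} {_⟶_ : Rel (Fin n) 0ℓ} (_⟶?_ : Decidable _⟶_) where

  private
    Via : List (Fin n) → Rel (Fin n) 0ℓ
    Via []       u v = u ≡ v ⊎ u ⟶ v
    Via (x ∷ xs) u v = Via xs u v ⊎ (Via xs u x × Via xs x v)

    via? : ∀ xs → Decidable (Via xs)
    via? []       u v = (u Fin.≟ v) ⊎-dec (u ⟶? v)
    via? (x ∷ xs) u v = via? xs u v ⊎-dec (via? xs u x ×-dec via? xs x v)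

    via⇒star : ∀ xs {u v} → Via xs u v → Star _⟶_ u v
    via⇒star []       (inj₁ refl)    = ε
    via⇒star []       (inj₂ e)       = e ◅ ε
    via⇒star (x ∷ xs) (inj₁ p)       = via⇒star xs p
    via⇒star (x ∷ xs) (inj₂ (p , q)) = via⇒star xs p ◅◅ via⇒star xs q

    via-base : ∀ xs {u v} → u ≡ v ⊎ u ⟶ v → Via xs u v
    via-base []       p = p
    via-base (x ∷ xs) p = inj₁ (via-base xs p)

    via-trans : ∀ xs {u w v} → w ∈ˡ xs → Via xs u w → Via xs w v → Via xs u v
    via-trans (x ∷ xs) (here refl) p q = inj₂ (Sum.[ (λ r → r) , proj₁ ] p , Sum.[ (λ r → r) , proj₂ ] q)
    via-trans (x ∷ xs) (there w∈) (inj₁ p) (inj₁ q) = inj₁ (via-trans xs w∈ p q)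
    via-trans (x ∷ xs) (there w∈) (inj₁ p) (inj₂ (q , r)) = inj₂ (via-trans xs w∈ p q , r)
    via-trans (x ∷ xs) (there w∈) (inj₂ (p , q)) (inj₁ r) = inj₂ (p , via-trans xs w∈ q r)
    via-trans (x ∷ xs) (there w∈) (inj₂ (p , _)) (inj₂ (_ , r)) = inj₂ (p , r)

    star⇒via : ∀ {u v} → Star _⟶_ u v → Via (allFin n) u v
    star⇒via ε       = via-base (allFin n) (inj₁ refl)
    star⇒via (e ◅ p) = via-trans (allFin n) (∈-allFin _) (via-base (allFin n) (inj₂ e)) (star⇒via p)

  reachable? : Decidable (Star _⟶_)
  reachable? u v = map′ (via⇒star (allFin n)) star⇒via (via? (allFin n) u v)

  reaches? : Decidable (Reaches _⟶_)
  reaches? S S′ = Fin.any? λ u → Fin.any? λ v →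
    (u ∈? S) ×-dec ((v ∈? S′) ×-dec reachable? u v)

  bottom? : ∀ L → Decidable₁ (Bottom _⟶_ L)
  bottom? L S = All.all? (λ S′ → reaches? S S′ →-dec (S′ ≟ˢ S)) L

record Game (n : ℕ) : Set where
  field
    Vₛ    : Subset n
    E     : Fin n → Subset n
    total : ∀ v → Nonempty (E v)
    F     : Subset n

  Vₑ : Subset n
  Vₑ = ∁ Vₛ

  _⟶_ : Rel (Fin n) 0ℓ
  u ⟶ v = v ∈ E u

  _⟶?_ : Decidable _⟶_
  u ⟶? v = v ∈? E u

module _ {n : ℕ} (G : Game n) where
  open Game G

  IsPlay : (ℕ → Fin n) → Set
  IsPlay ρ = ∀ i → ρ i ⟶ ρ (suc i)

  BüchiWinning : (ℕ → Fin n) → Set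
  BüchiWinning ρ = ∀ i → ∃[ j ] i ≤ j × ρ j ∈ F

  -- System strategies may depend on the list of nodes visited before the
  -- current node v.
  Strategy : Set
  Strategy = (history : List (Fin n)) (v : Fin n) → v ∈ Vₛ → Σ[ w ∈ Fin n ] w ∈ E v

  MemorylessStrategy : Set
  MemorylessStrategy = (v : Fin n) → v ∈ Vₛ → Σ[ w ∈ Fin n ] w ∈ E v

  memoryless : MemorylessStrategy → Strategy
  memoryless σ _ = σ

  Compatible : Strategy → (ℕ → Fin n) → Set
  Compatible σ ρ = ∀ i (s : ρ i ∈ Vₛ) → ρ (suc i) ≡ proj₁ (σ (applyUpTo ρ i) (ρ i) s)

  Wins : Strategy → Fin n → Set
  Wins σ v = ∀ ρ → IsPlay ρ → ρ 0 ≡ v → Compatible σ ρ → BüchiWinning ρ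

  WonBySystem : Fin n → Set
  WonBySystem v = ∃[ σ ] Wins σ v

-- Here X = Fin x, Y = Fin y and Q = Fin m.  The set AP = X ⊎ Y is
-- Fin (x + y), elements of X first, so that a ∪ b ⊆ AP is a ++ b.
record DWA (x y m : ℕ) : Set where
  field
    ι  : Fin m
    δ  : Fin m → Subset (x + y) → Fin m
    Fₜ : Subset m

  _↝_ : Rel (Fin m) 0ℓ
  q ↝ q′ = ∃[ a ] δ q a ≡ q′

  field
    weak : ∀ S → IsSCC _↝_ S → S ⊆ Fₜ ⊎ Empty (S ∩ Fₜ)

data Node (x y m : ℕ) : Set where
  state : Fin m → Node x y m
  half  : Fin m → Subset x → Node x y m
  full  : Fin m → Subset x → Subset y → Node x y m

module _ {x y m : ℕ} where

  component : Node x y m → Fin m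
  component (state q)    = q
  component (half q _)   = q
  component (full q _ _) = q

  data Edge (T : DWA x y m) : Rel (Node x y m) 0ℓ where
    system      : ∀ q a   → Edge T (state q) (half q a)
    environment : ∀ q a b → Edge T (half q a) (full q a b)
    update      : ∀ q a b → Edge T (full q a b) (state (DWA.δ T q (a ++ b)))

-- G is the game induced by T, its nodes being numbered by `nodes`.
record Induced {n x y m : ℕ} (G : Game n) (T : DWA x y m) : Set where
  open Game G
  field
    nodes : Fin n ↔ Node x y m

  open Inverse nodes using (to)

  field
    system⇔    : ∀ v → v ∈ Vₛ ⇔ (∃[ q ] to v ≡ state q)
    edge⇔      : ∀ u v → u ⟶ v ⇔ Edge T (to u) (to v)
    accepting⇔ : ∀ v → v ∈ F ⇔ component (to v) ∈ DWA.Fₜ T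

IsWeak : Game n → Set
IsWeak G = ∃[ x ] ∃[ y ] ∃[ m ] Σ[ T ∈ DWA x y m ] Induced G T

-- Computations with a cost: `p a t` means that p terminates with result
-- a after t symbolic operations, so a diverging p is the empty relation.

Comp : Set → Set₁
Comp A = A → ℕ → Set

return : A → Comp A
return a b t = b ≡ a × t ≡ 0

_>>=_ : Comp A → (A → Comp B) → Comp B
(p >>= f) b t = ∃[ a ] ∃[ t₁ ] ∃[ t₂ ] p a t₁ × f a b t₂ × t ≡ t₁ + t₂

charge : ℕ → A → Comp A
charge k a b t = b ≡ a × t ≡ k

_∪!_ _∩!_ : Subset n → Subset n → Comp (Subset n)
S ∪! T = charge 1 (S ∪ T)
S ∩! T = charge 1 (S ∩ T)

-- Iterate the body until it returns inj₂; no bound on the number of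
-- rounds is imposed.
data Loop (body : A → Comp (A ⊎ B)) : A → Comp B where
  exit : ∀ {a b t} → body a (inj₂ b) t → Loop body a b t
  next : ∀ {a a′ b t u} → body a (inj₁ a′) t → Loop body a′ b u → Loop body a b (t + u)

forEach : List A → B → (A → B → Comp B) → Comp B
forEach []       b f = return b
forEach (a ∷ as) b f = do
  b′ ← f a b
  forEach as b′ f

module _ {n : ℕ} (G : Game n) where
  open Game G

  ◇ □ CPreₛ : Subset n → Subset n
  ◇ W = tabulate λ v → does (nonempty? (E v ∩ W))
  □ W = tabulate λ v → does (E v ⊆? W)
  CPreₛ W = (Vₛ ∩ ◇ W) ∪ (Vₑ ∩ □ W)

  bottomSCCs : List (Subset n) → List (Subset n)
  bottomSCCs L = filter (bottom? _⟶?_ L) L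

_∖_ : List (Subset n) → List (Subset n) → List (Subset n)
L ∖ M = filter (λ S → ¬? (S ∈ˡ? M)) L
  where open DecMembership _≟ˢ_ renaming (_∈?_ to _∈ˡ?_)

-- The constant κ is the cost of evaluating CPreₛ, of one comparison of
-- subsets of V, and of the bookkeeping in the set of SCCs for each SCC
-- extracted from it by bottomSCCs.
module _ (κ : ℕ) {n : ℕ} (G : Game n) where
  open Game G

  fixpoint : (Subset n → Comp (Subset n)) → Subset n → Comp (Subset n)
  fixpoint f = Loop λ Z → do
    Z′     ← f Z
    stable ← charge κ (does (Z′ ≟ˢ Z))
    return (if stable then inj₂ Z′ else inj₁ Z′)

  step : Subset n → Subset n → Subset n → Comp (Subset n)
  step W T Z = do
    C ← charge κ (CPreₛ G Z)
    D ← W ∩! C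
    T ∪! D

  Reach Safe : Subset n → Subset n → Comp (Subset n)
  Reach W T = fixpoint (step W T) ⊥
  Safe  W T = fixpoint (step W T) ⊤

  process : Subset n → Subset n → Comp (Subset n)
  process S W = do
    S⊆F ← charge κ (does (S ⊆? F))
    Z   ← (if S⊆F then Safe S W else Reach S W)
    W ∪! Z

  round : List (Subset n) × Subset n → Comp ((List (Subset n) × Subset n) ⊎ Subset n)
  round ([]           , W) = return (inj₂ W)
  round (SCCs@(_ ∷ _) , W) = do
    B  ← charge (κ * length (bottomSCCs G SCCs)) (bottomSCCs G SCCs)
    W′ ← forEach B W process
    return (inj₁ (SCCs ∖ B , W′))

  SolveWeakSCC : List (Subset n) → Comp (Subset n)
  SolveWeakSCC SCCs = Loop round (SCCs , ⊥)

-- Computations are partial functions: all runs have the same result and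
-- the same cost, so existence of a run is termination.

Deterministic : Comp A → Set
Deterministic p = ∀ {a b t u} → p a t → p b u → a ≡ b × t ≡ u

return-det : (a : A) → Deterministic (return a)
return-det a (refl , refl) (refl , refl) = refl , refl

charge-det : ∀ k (a : A) → Deterministic (charge k a)
charge-det k a (refl , refl) (refl , refl) = refl , refl

>>=-det : {p : Comp A} {f : A → Comp B} →
          Deterministic p → (∀ a → Deterministic (f a)) → Deterministic (p >>= f)
>>=-det dp df (_ , _ , _ , p , q , refl) (_ , _ , _ , p′ , q′ , refl)
  with refl , refl ← dp p p′ with refl , refl ← df _ q q′ = refl , refl

Loop-det : {body : A → Comp (A ⊎ B)} →
           (∀ a → Deterministic (body a)) → ∀ a → Deterministic (Loop body a)
Loop-det d a (exit p) (exit q) with refl , refl ← d a p q = refl , refl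
Loop-det d a (exit p) (next q _) with () , _ ← d a p q
Loop-det d a (next p _) (exit q) with () , _ ← d a p q
Loop-det d a (next p r) (next q s)
  with refl , refl ← d a p q with refl , refl ← Loop-det d _ r s = refl , refl

forEach-det : ∀ (as : List A) (b : B) {f} →
              (∀ a b → Deterministic (f a b)) → Deterministic (forEach as b f)
forEach-det []       b d = return-det b
forEach-det (a ∷ as) b d = >>=-det (d a b) λ b′ → forEach-det as b′ d

module _ (κ : ℕ) {n : ℕ} (G : Game n) where
  open Game G

  fixpoint-det : ∀ {f} → (∀ Z → Deterministic (f Z)) → ∀ Z → Deterministic (fixpoint κ G f Z)
  fixpoint-det d = Loop-det λ Z →
    >>=-det (d Z) λ Z′ → >>=-det (charge-det κ _) λ stable → return-det _

  step-det : ∀ W T Z → Deterministic (step κ G W T Z)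
  step-det W T Z =
    >>=-det (charge-det κ _) λ C → >>=-det (charge-det 1 _) λ D → charge-det 1 _

  process-det : ∀ S W → Deterministic (process κ G S W)
  process-det S W = >>=-det (charge-det κ _) λ where
    true  → >>=-det (fixpoint-det (step-det S W) ⊤) λ Z → charge-det 1 _
    false → >>=-det (fixpoint-det (step-det S W) ⊥) λ Z → charge-det 1 _

  round-det : ∀ s → Deterministic (round κ G s)
  round-det ([]    , W) = return-det _
  round-det (_ ∷ _ , W) = >>=-det (charge-det _ _) λ B →
    >>=-det (forEach-det B W process-det) λ W′ → return-det _

  SolveWeakSCC-det : ∀ SCCs → Deterministic (SolveWeakSCC κ G SCCs)
  SolveWeakSCC-det SCCs = Loop-det round-det (SCCs , ⊥)

-- Reach and Safe compute μZ. T ∪ (W ∩ CPreₛ Z) and νZ. T ∪ (W ∩ CPreₛ Z).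

IsLeastFixpoint IsGreatestFixpoint : (Subset n → Subset n) → Subset n → Set
IsLeastFixpoint    f Z = f Z ≡ Z × (∀ Y → f Y ≡ Y → Z ⊆ Y)
IsGreatestFixpoint f Z = f Z ≡ Z × (∀ Y → f Y ≡ Y → Y ⊆ Z)

∈-tabulate⁺ : {P : Fin n → Set} (P? : Decidable₁ P) → ∀ {v} → P v → v ∈ tabulate (does ∘ P?)
∈-tabulate⁺ P? {v} p = lookup⇒[]= v _ (trans (lookup∘tabulate _ v) (does-true (P? v) p))
  where
  does-true : ∀ {P : Set} (d : Dec P) → P → does d ≡ true
  does-true (yes _) _ = refl
  does-true (no ¬p) p = ⊥-elim (¬p p)

∈-tabulate⁻ : {P : Fin n → Set} (P? : Decidable₁ P) → ∀ {v} → v ∈ tabulate (does ∘ P?) → P v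
∈-tabulate⁻ P? {v} v∈ = true-does (P? v) (trans (sym (lookup∘tabulate _ v)) ([]=⇒lookup v∈))
  where
  true-does : ∀ {P : Set} (d : Dec P) → does d ≡ true → P
  true-does (yes p) _ = p

module _ (κ : ℕ) {n : ℕ} (G : Game n) where
  open Game G

  CPreₛ-mono : ∀ {Y Z} → Y ⊆ Z → CPreₛ G Y ⊆ CPreₛ G Z
  CPreₛ-mono {Y} {Z} Y⊆Z {v} v∈ with x∈p∪q⁻ (Vₛ ∩ ◇ G Y) (Vₑ ∩ □ G Y) v∈
  ... | inj₁ v∈◇ with s , d ← x∈p∩q⁻ Vₛ (◇ G Y) v∈◇
                 with w , w∈ ← ∈-tabulate⁻ (λ v → nonempty? (E v ∩ Y)) d
                 with e , y ← x∈p∩q⁻ (E v) Y w∈ =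
    x∈p∪q⁺ (inj₁ (x∈p∩q⁺ (s , ∈-tabulate⁺ (λ v → nonempty? (E v ∩ Z))
                                 (w , x∈p∩q⁺ (e , Y⊆Z y)))))
  ... | inj₂ v∈□ with s , b ← x∈p∩q⁻ Vₑ (□ G Y) v∈□ =
    x∈p∪q⁺ (inj₂ (x∈p∩q⁺ (s , ∈-tabulate⁺ (λ v → E v ⊆? Z)
                                 λ e → Y⊆Z (∈-tabulate⁻ (λ v → E v ⊆? Y) b e))))

  module _ (W T : Subset n) where

    φ : Subset n → Subset n
    φ Z = T ∪ (W ∩ CPreₛ G Z)

    φ-mono : ∀ {Y Z} → Y ⊆ Z → φ Y ⊆ φ Z
    φ-mono {Y} Y⊆Z v∈ with x∈p∪q⁻ T (W ∩ CPreₛ G Y) v∈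
    ... | inj₁ t = x∈p∪q⁺ (inj₁ t)
    ... | inj₂ u with w , c ← x∈p∩q⁻ W (CPreₛ G Y) u =
      x∈p∪q⁺ (inj₂ (x∈p∩q⁺ (w , CPreₛ-mono Y⊆Z c)))

    private
      -- An invariant of φ that holds initially holds at the end, and the
      -- result is a fixpoint.
      run : (I : Subset n → Set) → (∀ {Z} → I Z → I (φ Z)) →
            ∀ {Z R t} → I Z → fixpoint κ G (step κ G W T) Z R t → φ R ≡ R × I R
      run I pres {Z} i (exit (_ , _ , _ , (_ , _ , _ , (refl , _) , (_ , _ , _ , (refl , _) , (refl , _) , _) , _)
                               , (_ , _ , _ , (refl , _) , (eq , _) , _) , _))
        with φ Z ≟ˢ Z
      run I pres i (exit (_ , _ , _ , (_ , _ , _ , (refl , _) , (_ , _ , _ , (refl , _) , (refl , _) , _) , _)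
                               , (_ , _ , _ , (refl , _) , (refl , _) , _) , _))
        | yes p = cong φ p , pres i
      run I pres {Z} i (next (_ , _ , _ , (_ , _ , _ , (refl , _) , (_ , _ , _ , (refl , _) , (refl , _) , _) , _)
                               , (_ , _ , _ , (refl , _) , (eq , _) , _) , _) l)
        with φ Z ≟ˢ Z
      run I pres i (next (_ , _ , _ , (_ , _ , _ , (refl , _) , (_ , _ , _ , (refl , _) , (refl , _) , _) , _)
                               , (_ , _ , _ , (refl , _) , (refl , _) , _) , _) l)
        | no _ = run I pres (pres i) l

    Reach-μ : ∀ {Z t} → Reach κ G W T Z t → IsLeastFixpoint φ Z
    Reach-μ r = proj₁ (run (λ _ → ℕ) (λ i → i) 0 r) ,
      λ Y eq → proj₂ (run (_⊆ Y) (λ Z⊆Y {v} v∈ → subst (v ∈_) eq (φ-mono Z⊆Y v∈)) (⊆-min Y) r)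

    Safe-ν : ∀ {Z t} → Safe κ G W T Z t → IsGreatestFixpoint φ Z
    Safe-ν r = proj₁ (run (λ _ → ℕ) (λ i → i) 0 r) ,
      λ Y eq → proj₂ (run (Y ⊆_) (λ Y⊆Z {v} v∈ → φ-mono Y⊆Z (subst (v ∈_) (sym eq) v∈)) (⊆-max Y) r)

{-# OPTIONS --safe #-}
module Submission where

-- Both winning regions are certified by a rank which does not increase along
-- the moves of the owner's memoryless strategy and drops at each node that is
-- bad for the owner (a node outside F for the system, a node of F for the
-- environment), so bad nodes occur only finitely often.  On a rejecting bottom
-- SCC, Reach is an attractor for the system whose complement is a trap for the
-- environment free of bad nodes; on an accepting one, the roles are exchanged
-- and the complement of Safe is the attractor of the environment.  The moves
-- out of a bottom SCC lead to nodes already decided.  For the time, a fixpoint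
-- iteration on S changes membership of nodes of S only, apart from its first
-- round, and the SCCs partition V into nonempty sets.

open import Defs
open import Data.Bool using (true; false; if_then_else_)
open import Data.Fin using (Fin)
import Data.Fin.Properties as Fin
open import Data.Fin.Subset
  using (Subset; inside; outside; _∈_; _∉_; _⊆_; _∪_; _∩_; ∁; ⊥; ⊤; ⁅_⁆; ∣_∣; Nonempty; Empty)
open import Data.Fin.Subset.Properties
  using (_∈?_; _⊆?_; nonempty?; anySubset?; ⊆-antisym; ⊆-min; ∉⊥; ∈⊤; x∈⁅x⁆; x∈⁅y⁆⇒x≡y
        ; x∈p∩q⁺; x∈p∩q⁻; x∈p∪q⁺; x∈p∪q⁻; p⊆p∪q; q⊆p∪q
        ; x∈p⇒x∉∁p; x∈∁p⇒x∉p; x∉∁p⇒x∈p; x∉p⇒x∈∁p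
        ; ∣p∣≤n; p⊂q⇒∣p∣<∣q∣; ∣p∩q∣≤∣p∣)
open import Data.List using (List; []; _∷_; _∷ʳ_; applyUpTo; length)
import Data.List.Membership.DecPropositional as DecMembership
open import Data.List.Membership.Propositional using (find; lose) renaming (_∈_ to _∈ˡ_)
open import Data.List.Membership.Propositional.Properties using (∈-filter⁺; ∈-filter⁻)
open import Data.List.Properties using (applyUpTo-∷ʳ; filter-notAll)
open import Data.List.Relation.Unary.All as All using (All; []; _∷_)
open import Data.List.Relation.Unary.AllPairs using ([]; _∷_)
open import Data.List.Relation.Unary.Any using (Any; here; there)
open import Data.List.Relation.Unary.Unique.Propositional using (Unique)
import Data.List.Relation.Unary.Unique.Propositional.Properties as Unique
open import Data.Nat using (ℕ; zero; suc; _+_; _*_; _∸_; _≤_; _<_; z≤n; s≤s)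
open import Data.Nat.Properties
  using (≤-refl; ≤-trans; ≤-reflexive; ≤-pred; <⇒≤; n≤1+n; m≤m+n; m≤n+m; m∸n+n≡m
        ; +-suc; +-monoˡ-≤; +-monoʳ-≤; *-comm; *-zeroʳ; *-monoʳ-≤; module ≤-Reasoning)
open import Data.Nat.Tactic.RingSolver using (solve-∀)
open import Data.Product using (Σ-syntax; ∃-syntax; _×_; _,_; proj₁; proj₂)
open import Data.Sum using (_⊎_; inj₁; inj₂; [_,_]′; map₁; map₂)
open import Data.Vec using ([]; _∷_; here; there; tabulate)
open import Data.Vec.Properties.WithK using ([]=-irrelevant)
open import Function using (_∘_; id)
open import Function.Bundles using (_⇔_; mk⇔; Equivalence; Inverse)
open import Level using (0ℓ)
open import Relation.Binary using (Rel; Decidable)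
open import Relation.Binary.Construct.Closure.ReflexiveTransitive using (Star; ε; _◅_; _◅◅_)
open import Relation.Binary.PropositionalEquality
  using (_≡_; _≢_; refl; sym; trans; cong; subst)
open import Relation.Nullary using (¬_; yes; no; does; contradiction)
open import Relation.Nullary.Decidable using (_×-dec_; ¬?; decidable-stable; dec-true; dec-false)

open module SubsetMembership {n} = DecMembership (_≟ˢ_ {n}) using () renaming (_∈?_ to _∈ˡ?_)

private
  variable
    n : ℕ

-- Finite subsets and their cardinalities.

⊈⇒∃ : {p q : Subset n} → ¬ p ⊆ q → ∃[ v ] v ∈ p × v ∉ q
⊈⇒∃ {p = p} {q} p⊈q with nonempty? (p ∩ ∁ q)
... | yes (v , v∈) with v∈p , v∈∁q ← x∈p∩q⁻ p (∁ q) v∈ = v , v∈p , x∈∁p⇒x∉p v∈∁q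
... | no empty = contradiction
  (λ {v} v∈p → decidable-stable (v ∈? q) λ v∉q → empty (v , x∈p∩q⁺ (v∈p , x∉p⇒x∈∁p v∉q)))
  p⊈q

⊆∧≢⇒∃ : {p q : Subset n} → p ⊆ q → p ≢ q → ∃[ v ] v ∈ q × v ∉ p
⊆∧≢⇒∃ p⊆q p≢q = ⊈⇒∃ λ q⊆p → p≢q (⊆-antisym p⊆q q⊆p)

∣p∪q∣≡∣p∣+∣q∣ : (p q : Subset n) → (∀ {v} → v ∈ p → v ∉ q) → ∣ p ∪ q ∣ ≡ ∣ p ∣ + ∣ q ∣
∣p∪q∣≡∣p∣+∣q∣ []            []            _ = refl
∣p∪q∣≡∣p∣+∣q∣ (inside  ∷ p) (inside  ∷ q) d = contradiction here (d here)
∣p∪q∣≡∣p∣+∣q∣ (inside  ∷ p) (outside ∷ q) d =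
  cong suc (∣p∪q∣≡∣p∣+∣q∣ p q λ a b → d (there a) (there b))
∣p∪q∣≡∣p∣+∣q∣ (outside ∷ p) (inside  ∷ q) d =
  trans (cong suc (∣p∪q∣≡∣p∣+∣q∣ p q λ a b → d (there a) (there b))) (sym (+-suc ∣ p ∣ ∣ q ∣))
∣p∪q∣≡∣p∣+∣q∣ (outside ∷ p) (outside ∷ q) d =
  ∣p∪q∣≡∣p∣+∣q∣ p q λ a b → d (there a) (there b)

0<∣p∣ : {p : Subset n} {v : Fin n} → v ∈ p → 0 < ∣ p ∣
0<∣p∣ {p = p} v∈ = ≤-trans (s≤s z≤n) (p⊂q⇒∣p∣<∣q∣ (⊆-min p , _ , v∈ , ∉⊥))

-- Strongly connected components

module _ {n : ℕ} {_⟶_ : Rel (Fin n) 0ℓ} where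

  -- The union of the two sets is again mutually reachable, through the common node `v`, so by
  -- maximality both equal it.
  SCC-unique : ∀ {S S′ v} → IsSCC _⟶_ S → IsSCC _⟶_ S′ → v ∈ S → v ∈ S′ → S ≡ S′
  SCC-unique {S} {S′} {v} (mut , max) (mut′ , max′) v∈S v∈S′ =
    ⊆-antisym (λ u∈ → max′ (S ∪ S′) mut∪ (q⊆p∪q S S′) (p⊆p∪q S′ u∈))
              (λ u∈ → max  (S ∪ S′) mut∪ (p⊆p∪q S′) (q⊆p∪q S S′ u∈))
    where
    mut∪ : MutuallyReachable _⟶_ (S ∪ S′)
    mut∪ {u} {w} u∈ w∈ = [ (λ p → mut p v∈S) , (λ p → mut′ p v∈S′) ]′ (x∈p∪q⁻ S S′ u∈)
                      ◅◅ [ mut v∈S , mut′ v∈S′ ]′ (x∈p∪q⁻ S S′ w∈)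

  -- The singleton `⁅ v ⁆` is mutually reachable, so an empty set is not maximal. Without any node
  -- the empty set would be an SCC, hence the argument `Fin n`.
  SCC-nonempty : Fin n → ∀ {S} → IsSCC _⟶_ S → Nonempty S
  SCC-nonempty v {S} (_ , max) with nonempty? S
  ... | yes ne   = ne
  ... | no empty = v , max ⁅ v ⁆ mut (λ u∈ → contradiction (_ , u∈) empty) (x∈⁅x⁆ v)
    where
    mut : MutuallyReachable _⟶_ ⁅ v ⁆
    mut a b with refl ← x∈⁅y⁆⇒x≡y v a with refl ← x∈⁅y⁆⇒x≡y v b = ε

  -- The two connections close a cycle through `u`, so `S ∪ S′` is mutually reachable and maximality
  -- applies to both sets.
  Reaches-antisym : ∀ {S S′} → IsSCC _⟶_ S → IsSCC _⟶_ S′ →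
                    Reaches _⟶_ S S′ → Reaches _⟶_ S′ S → S ≡ S′
  Reaches-antisym {S} {S′} (mut , max) (mut′ , max′) (u , v , u∈ , v∈ , p) (v′ , u′ , v′∈ , u′∈ , q) =
    ⊆-antisym (λ w∈ → max′ (S ∪ S′) mut∪ (q⊆p∪q S S′) (p⊆p∪q S′ w∈))
              (λ w∈ → max  (S ∪ S′) mut∪ (p⊆p∪q S′) (q⊆p∪q S S′ w∈))
    where
    to-u : ∀ {w} → w ∈ S ∪ S′ → Star _⟶_ w u
    to-u w∈ = [ (λ a → mut a u∈) , (λ a → mut′ a v′∈ ◅◅ q ◅◅ mut u′∈ u∈) ]′ (x∈p∪q⁻ S S′ w∈)

    from-u : ∀ {w} → w ∈ S ∪ S′ → Star _⟶_ u w
    from-u w∈ = [ mut u∈ , (λ a → p ◅◅ mut′ v∈ a) ]′ (x∈p∪q⁻ S S′ w∈)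

    mut∪ : MutuallyReachable _⟶_ (S ∪ S′)
    mut∪ a b = to-u a ◅◅ from-u b

  Reaches-trans : ∀ {S S′ S″} → MutuallyReachable _⟶_ S′ →
                  Reaches _⟶_ S S′ → Reaches _⟶_ S′ S″ → Reaches _⟶_ S S″
  Reaches-trans mut (u , v , u∈ , v∈ , p) (v′ , w , v′∈ , w∈ , q) =
    u , w , u∈ , w∈ , p ◅◅ mut v∈ v′∈ ◅◅ q

  module _ (_⟶?_ : Decidable _⟶_) where

    SCC-of : Fin n → Subset n
    SCC-of v = tabulate λ u → does (reachable? _⟶?_ u v ×-dec reachable? _⟶?_ v u)

    SCC-of⁺ : ∀ {u v} → Star _⟶_ u v → Star _⟶_ v u → u ∈ SCC-of v
    SCC-of⁺ {v = v} p q =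
      ∈-tabulate⁺ (λ u → reachable? _⟶?_ u v ×-dec reachable? _⟶?_ v u) (p , q)

    SCC-of⁻ : ∀ {u v} → u ∈ SCC-of v → Star _⟶_ u v × Star _⟶_ v u
    SCC-of⁻ {v = v} = ∈-tabulate⁻ (λ u → reachable? _⟶?_ u v ×-dec reachable? _⟶?_ v u)

    SCC-of-isSCC : ∀ v → IsSCC _⟶_ (SCC-of v)
    SCC-of-isSCC v =
      (λ a b → proj₁ (SCC-of⁻ a) ◅◅ proj₂ (SCC-of⁻ b)) ,
      (λ S mut ⊆S u∈ → SCC-of⁺ (mut u∈ (⊆S (SCC-of⁺ ε ε))) (mut (⊆S (SCC-of⁺ ε ε)) u∈))

    -- The candidate from the tail survives unless it reaches `S`; then `S` takes over. This makes
    -- every round of the algorithm remove an SCC.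
    ∃-bottom : ∀ S L → (∀ {S′} → S′ ∈ˡ S ∷ L → IsSCC _⟶_ S′) →
               ∃[ M ] M ∈ˡ S ∷ L × Bottom _⟶_ (S ∷ L) M
    ∃-bottom S []       scc = S , here refl , (λ _ → refl) ∷ []
    ∃-bottom S (S′ ∷ L) scc with M , M∈ , bot ← ∃-bottom S′ L (scc ∘ there)
                            with reaches? _⟶?_ M S
    ... | no ¬M→S = M , there M∈ , (λ M→S → contradiction M→S ¬M→S) ∷ bot
    ... | yes M→S = S , here refl , (λ _ → refl) ∷ All.tabulate back
      where
      back : ∀ {S″} → S″ ∈ˡ S′ ∷ L → Reaches _⟶_ S S″ → S″ ≡ S
      -- Whatever `S` reaches in the tail is reached from `M` through `S`, so it is `M` itself; then
      -- `M` and `S` reach each other.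
      back S″∈ S→S″
        with refl ← All.lookup bot S″∈ (Reaches-trans (proj₁ (scc (here refl))) M→S S→S″) =
        Reaches-antisym (scc (there M∈)) (scc (here refl)) M→S S→S″

-- Weakness carried over from the automaton to the arena.

module _ {x y m : ℕ} (T : DWA x y m) where
  open DWA T

  _↝?_ : Decidable _↝_
  q ↝? q′ = anySubset? λ a → δ q a Fin.≟ q′

  Fₜ-invariant : ∀ {q q′} → Star _↝_ q q′ → Star _↝_ q′ q → q ∈ Fₜ → q′ ∈ Fₜ
  Fₜ-invariant {q} {q′} p r q∈ with weak (SCC-of _↝?_ q) (SCC-of-isSCC _↝?_ q)
  ... | inj₁ ⊆Fₜ   = ⊆Fₜ (SCC-of⁺ _↝?_ r p)
  ... | inj₂ empty = contradiction (q , x∈p∩q⁺ (SCC-of⁺ _↝?_ ε ε , q∈)) empty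

  edge⇒star : ∀ {u v} → Edge T u v → Star _↝_ (component u) (component v)
  edge⇒star (system q a)        = ε
  edge⇒star (environment q a b) = ε
  edge⇒star (update q a b)      = (_ , refl) ◅ ε

module _ {n : ℕ} {G : Game n} where
  open Game G

  -- The initial state makes the arena nonempty, as `SCC-nonempty` requires.
  IsWeak⇒node : IsWeak G → Fin n
  IsWeak⇒node (_ , _ , _ , T , ind) = Inverse.from (Induced.nodes ind) (state (DWA.ι T))

  -- Arena paths project to automaton paths between components, so mutually reachable nodes have
  -- mutually reachable components, which agree on `Fₜ`.
  IsWeak⇒SCC : IsWeak G → ∀ {S} → IsSCC _⟶_ S → S ⊆ F ⊎ Empty (S ∩ F)
  IsWeak⇒SCC (_ , _ , _ , T , ind) {S} (mut , _) with nonempty? (S ∩ F)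
  ... | no empty = inj₂ empty
  ... | yes (u , u∈) with u∈S , u∈F ← x∈p∩q⁻ S F u∈ = inj₁ λ {v} v∈S →
    Equivalence.from (accepting⇔ v)
      (Fₜ-invariant T (path (mut u∈S v∈S)) (path (mut v∈S u∈S)) (Equivalence.to (accepting⇔ u) u∈F))
    where
    open Induced ind
    open Inverse nodes using (to)

    path : ∀ {u v} → Star _⟶_ u v → Star (DWA._↝_ T) (component (to u)) (component (to v))
    path ε       = ε
    path (e ◅ p) = edge⇒star T (Equivalence.to (edge⇔ _ _) e) ◅◅ path p

-- Winning certificates

module _ {n : ℕ} (G : Game n) where
  open Game G

  Forces : Subset n → (Fin n → Set) → Fin n → Set
  Forces A Q v = (v ∈ A → ∃[ w ] w ∈ E v × Q w) × (v ∉ A → ∀ {w} → w ∈ E v → Q w)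

  Forces-map : ∀ {A v} {Q Q′ : Fin n → Set} → (∀ {w} → w ∈ E v → Q w → Q′ w) →
               Forces A Q v → Forces A Q′ v
  Forces-map f (own , opp) = (λ a → let w , e , q = own a in w , e , f e q)
                           , (λ a e → f e (opp a e))

  -- A rank witnessing that the owner of A can stay in X forever while
  -- visiting `bad` only finitely often.
  record Certificate (A bad X : Subset n) : Set where
    field
      rank       : Fin n → ℕ
      bound      : ℕ
      rank<bound : ∀ v → rank v < bound

    Descent : Fin n → Fin n → Set
    Descent v w = w ∈ X × rank w ≤ rank v × (v ∈ bad → rank w < rank v)

    field
      forced : ∀ {v} → v ∈ X → Forces A (Descent v) v

  ⊥-certificate : ∀ {A bad X} → Empty X → Certificate A bad X
  ⊥-certificate empty = record
    { rank       = λ _ → 0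
    ; bound      = 1
    ; rank<bound = λ _ → s≤s z≤n
    ; forced     = λ v∈ → contradiction (_ , v∈) empty
    }

  -- New nodes get the old bound as rank; this covers both an attractor
  -- step (moves lead into X) and a new trap (moves stay in X′ ∖ X, off bad).
  extend : ∀ {A bad X X′} → Certificate A bad X → X ⊆ X′ →
           (∀ {v} → v ∈ X′ → v ∉ X → Forces A (λ w → w ∈ X′ × (v ∈ bad → w ∈ X)) v) →
           Certificate A bad X′
  extend {A} {bad} {X} {X′} c X⊆X′ new = record
    { rank       = rank′
    ; bound      = suc bound
    ; rank<bound = λ v → s≤s (rank′≤bound v)
    ; forced     = forced′
    }
    where
    open Certificate c

    rank′ : Fin n → ℕ
    rank′ v with v ∈? X
    ... | yes _ = rank v
    ... | no  _ = bound

    rank′-old : ∀ {v} → v ∈ X → rank′ v ≡ rank v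
    rank′-old {v} v∈ with v ∈? X
    ... | yes _ = refl
    ... | no v∉ = contradiction v∈ v∉

    rank′≤bound : ∀ v → rank′ v ≤ bound
    rank′≤bound v with v ∈? X
    ... | yes _ = <⇒≤ (rank<bound v)
    ... | no  _ = ≤-refl

    forced′ : ∀ {v} → v ∈ X′ →
              Forces A (λ w → w ∈ X′ × rank′ w ≤ rank′ v × (v ∈ bad → rank′ w < rank′ v)) v
    forced′ {v} v∈ with v ∈? X
    ... | yes v∈X = Forces-map
      (λ {w} _ (w∈ , le , lt) → X⊆X′ w∈ , subst (_≤ rank v) (sym (rank′-old w∈)) le
                              , λ b → subst (_< rank v) (sym (rank′-old w∈)) (lt b))
      (forced v∈X)
    ... | no v∉X = Forces-map
      (λ {w} _ (w∈ , old) → w∈ , rank′≤bound w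
                          , λ b → subst (_< bound) (sym (rank′-old (old b))) (rank<bound w))
      (new v∈ v∉X)

  module _ {A bad X : Subset n} (c : Certificate A bad X) where
    open Certificate c

    -- A strategy must be defined everywhere, so outside `X` any successor serves. `Descent` is
    -- returned under the condition `v ∈ X`, so that it can be recovered for the very move chosen.
    respond : ∀ v → v ∈ A → ∃[ w ] w ∈ E v × (v ∈ X → Descent v w)
    respond v v∈A with v ∈? X
    ... | no v∉X = let w , e = total v in w , e , λ v∈X → contradiction v∈X v∉X
    ... | yes v∈X = let w , e , d = proj₁ (forced v∈X) v∈A in w , e , λ _ → d

    strategy : ∀ v → v ∈ A → Σ[ w ∈ Fin n ] w ∈ E v
    strategy v v∈A = let w , e , _ = respond v v∈A in w , e

    module _ {ρ : ℕ → Fin n} (play : IsPlay G ρ)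
             (follows : ∀ i (a : ρ i ∈ A) → ρ (suc i) ≡ proj₁ (strategy (ρ i) a))
             (start : ρ 0 ∈ X) where

      descent : ∀ i → ρ i ∈ X → Descent (ρ i) (ρ (suc i))
      descent i i∈X with ρ i ∈? A
      ... | yes a rewrite follows i a = proj₂ (proj₂ (respond (ρ i) a)) i∈X
      ... | no ¬a = proj₂ (forced i∈X) ¬a (play i)

      stays : ∀ i → ρ i ∈ X
      stays zero    = start
      stays (suc i) = proj₁ (descent i (stays i))

      -- Along consecutive bad nodes the rank drops strictly, so the forward search ends before the
      -- fuel `k`, a strict bound on the rank, runs out.
      avoids-bad : ∀ i → ∃[ j ] i ≤ j × ρ j ∉ bad
      avoids-bad i = go bound i (rank<bound (ρ i))
        where
        go : ∀ k i → rank (ρ i) < k → ∃[ j ] i ≤ j × ρ j ∉ bad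
        go (suc k) i lt with ρ i ∈? bad
        ... | no ¬b = i , ≤-refl , ¬b
        ... | yes b with j , i<j , ¬b ← go k (suc i)
                           (≤-trans (proj₂ (proj₂ (descent i (stays i))) b) (≤-pred lt)) =
          j , ≤-trans (n≤1+n i) i<j , ¬b

      rank-antitone : ∀ {i j} → i ≤ j → rank (ρ j) ≤ rank (ρ i)
      rank-antitone {i} {j} i≤j = subst (λ j → rank (ρ j) ≤ rank (ρ i)) (m∸n+n≡m i≤j) (go (j ∸ i))
        where
        go : ∀ k → rank (ρ (k + i)) ≤ rank (ρ i)
        go zero    = ≤-refl
        go (suc k) = ≤-trans (proj₁ (proj₂ (descent (k + i) (stays (k + i))))) (go k)

      bad-finitely-often : ¬ (∀ i → ∃[ j ] i ≤ j × ρ j ∈ bad)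
      bad-finitely-often inf = go bound 0 (rank<bound (ρ 0))
        where
        go : ∀ k i → ¬ rank (ρ i) < k
        go (suc k) i lt with j , i≤j , b ← inf i =
          go k (suc j) (≤-trans (proj₂ (proj₂ (descent j (stays j))) b)
                                (≤-trans (rank-antitone i≤j) (≤-pred lt)))

  SystemCertificate EnvironmentCertificate : Subset n → Set
  SystemCertificate      = Certificate Vₛ (∁ F)
  EnvironmentCertificate = Certificate Vₑ F

  system-wins : ∀ {X} (c : SystemCertificate X) {v} → v ∈ X → Wins G (memoryless G (strategy c)) v
  system-wins c v∈X ρ play refl compatible i
    with j , i≤j , j∉ ← avoids-bad c play compatible v∈X i = j , i≤j , x∉∁p⇒x∈p j∉

  module Outcome (σ : Strategy G) (τ : ∀ v → v ∈ Vₑ → Σ[ w ∈ Fin n ] w ∈ E v) (v₀ : Fin n) where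

    move : List (Fin n) → ∀ v → Σ[ w ∈ Fin n ] w ∈ E v
    move h v with v ∈? Vₛ
    ... | yes s = σ h v s
    ... | no ¬s = τ v (x∉p⇒x∈∁p ¬s)

    position : ℕ → List (Fin n) × Fin n
    position zero    = [] , v₀
    position (suc i) = let h , v = position i in h ∷ʳ v , proj₁ (move h v)

    outcome : ℕ → Fin n
    outcome i = proj₂ (position i)

    history : ∀ i → proj₁ (position i) ≡ applyUpTo outcome i
    history zero    = refl
    history (suc i) = trans (cong (_∷ʳ outcome i) (history i)) (applyUpTo-∷ʳ outcome i)

    isPlay : IsPlay G outcome
    isPlay i = let h , v = position i in proj₂ (move h v)

    compatible : Compatible G σ outcome
    compatible i s rewrite sym (history i) with outcome i ∈? Vₛ
    -- `move` passes to `σ` the membership proof found by `∈?`, not `s`; irrelevance of such proofs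
    -- identifies the two.
    ... | yes s′ rewrite []=-irrelevant s s′ = refl
    ... | no ¬s  = contradiction s ¬s

    follows : ∀ i (a : outcome i ∈ Vₑ) → outcome (suc i) ≡ proj₁ (τ (outcome i) a)
    follows i a with outcome i ∈? Vₛ
    ... | yes s = contradiction a (x∈p⇒x∉∁p s)
    ... | no ¬s rewrite []=-irrelevant a (x∉p⇒x∈∁p ¬s) = refl

  -- Against any `σ` the certificate's strategy produces a play compatible with `σ` that visits `F`
  -- only finitely often.
  environment-wins : ∀ {X} → EnvironmentCertificate X → ∀ {v} → v ∈ X → ¬ WonBySystem G v
  environment-wins c {v} v∈X (σ , wins) =
    bad-finitely-often c isPlay follows v∈X (wins outcome isPlay refl compatible)
    where open Outcome σ (strategy c) v

  ∈CPreₛ⁻ : ∀ {Z v} → v ∈ CPreₛ G Z → Forces Vₛ (_∈ Z) v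
  ∈CPreₛ⁻ {Z} {v} v∈ with x∈p∪q⁻ (Vₛ ∩ ◇ G Z) (Vₑ ∩ □ G Z) v∈
  ... | inj₁ v∈◇ with s , d ← x∈p∩q⁻ Vₛ (◇ G Z) v∈◇
                 with w , w∈ ← ∈-tabulate⁻ (λ v → nonempty? (E v ∩ Z)) d
                 with e , z ← x∈p∩q⁻ (E v) Z w∈ =
    (λ _ → w , e , z) , (λ ¬s → contradiction s ¬s)
  ... | inj₂ v∈□ with ¬s , b ← x∈p∩q⁻ Vₑ (□ G Z) v∈□ =
    (λ s → contradiction ¬s (x∈p⇒x∉∁p s)) , (λ _ e → ∈-tabulate⁻ (λ v → E v ⊆? Z) b e)

  -- Complementing `CPreₛ` exchanges the players: the environment can keep the next node out of `Z`.
  ∉CPreₛ⁻ : ∀ {Z v} → v ∉ CPreₛ G Z → Forces Vₑ (_∉ Z) v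
  ∉CPreₛ⁻ {Z} {v} v∉ =
    (λ ¬s → ⊈⇒∃ λ Ev⊆Z → v∉ (x∈p∪q⁺ (inj₂ (x∈p∩q⁺ (¬s , ∈-tabulate⁺ (λ v → E v ⊆? Z) Ev⊆Z))))) ,
    (λ s {w} e z → v∉ (x∈p∪q⁺ (inj₁ (x∈p∩q⁺
      (x∉∁p⇒x∈p s , ∈-tabulate⁺ (λ v → nonempty? (E v ∩ Z)) (w , x∈p∩q⁺ (e , z)))))))

  -- W is the part of the processed set P won by the system.
  record Solved (P W : Subset n) : Set where
    field
      W⊆P     : W ⊆ P
      sysCert : SystemCertificate W
      envCert : EnvironmentCertificate (P ∩ ∁ W)

-- The fixpoint iterations and their cost

-- One evaluation of `CPreₛ`, two set operations and one comparison, left unsimplified so that the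
-- sums produced by the monadic code match it by `refl`.
iterationCost : ℕ → ℕ
iterationCost κ = (κ + 2) + (κ + 0)

-- The initial round, at most `k` rounds that lower the measure, and the last round, which detects
-- stability.
fixpointCost : ℕ → ℕ → ℕ
fixpointCost κ k = (2 + k) * iterationCost κ

module _ (κ : ℕ) {n : ℕ} (G : Game n) (S W : Subset n) where
  open Game G

  private
    Φ : Subset n → Subset n
    Φ = φ κ G S W

  W⊆φ : ∀ Z → W ⊆ Φ Z
  W⊆φ Z = p⊆p∪q (S ∩ CPreₛ G Z)

  ∈φ⁻ : ∀ {Z v} → v ∈ Φ Z → v ∈ W ⊎ v ∈ S × v ∈ CPreₛ G Z
  ∈φ⁻ {Z} v∈ with x∈p∪q⁻ W (S ∩ CPreₛ G Z) v∈
  ... | inj₁ v∈W = inj₁ v∈W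
  ... | inj₂ v∈∩ = inj₂ (x∈p∩q⁻ S (CPreₛ G Z) v∈∩)

  ∉φ⇒∉CPreₛ : ∀ {Z v} → v ∈ S → v ∉ Φ Z → v ∉ CPreₛ G Z
  ∉φ⇒∉CPreₛ v∈S v∉ v∈C = v∉ (x∈p∪q⁺ (inj₂ (x∈p∩q⁺ (v∈S , v∈C))))

  fixpoint-exit : ∀ {Z} → Φ Z ≡ Z → fixpoint κ G (step κ G S W) Z (Φ Z) (iterationCost κ)
  fixpoint-exit {Z} eq = exit
    ( Φ Z , κ + 2 , κ + 0
    , (_ , _ , _ , (refl , refl) , (_ , _ , _ , (refl , refl) , (refl , refl) , refl) , refl)
    , (_ , _ , _ , (refl , refl) , (stable , refl) , refl) , refl)
    where
    stable : inj₂ (Φ Z) ≡ (if does (Φ Z ≟ˢ Z) then inj₂ (Φ Z) else inj₁ (Φ Z))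
    stable rewrite dec-true (Φ Z ≟ˢ Z) eq = refl

  fixpoint-next : ∀ {Z R t} → Φ Z ≢ Z → fixpoint κ G (step κ G S W) (Φ Z) R t →
                  fixpoint κ G (step κ G S W) Z R (iterationCost κ + t)
  fixpoint-next {Z} neq = next
    ( Φ Z , κ + 2 , κ + 0
    , (_ , _ , _ , (refl , refl) , (_ , _ , _ , (refl , refl) , (refl , refl) , refl) , refl)
    , (_ , _ , _ , (refl , refl) , (unstable , refl) , refl) , refl)
    where
    unstable : inj₁ (Φ Z) ≡ (if does (Φ Z ≟ˢ Z) then inj₂ (Φ Z) else inj₁ (Φ Z))
    unstable rewrite dec-false (Φ Z ≟ˢ Z) neq = refl

  -- After the first iteration Z lies between W and W ∪ S, so only then
  -- must the measure decrease.
  module _ (I : Subset n → Set) (μ : Subset n → ℕ)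
           (pres : ∀ {Z} → I Z → I (Φ Z))
           (μ≤∣S∣ : ∀ Z → μ Z ≤ ∣ S ∣)
           (μ-decreases : ∀ {Z} → I Z → W ⊆ Z → (∀ {v} → v ∈ Z → v ∈ W ⊎ v ∈ S) →
                          Φ Z ≢ Z → μ (Φ Z) < μ Z) where

    FixpointRun : Subset n → ℕ → Set
    FixpointRun Z k = ∃[ R ] ∃[ t ] fixpoint κ G (step κ G S W) Z R t
                      × Φ R ≡ R × I R × t ≤ k * iterationCost κ

    fixpoint-run′ : ∀ k {Z} → I (Φ Z) → μ (Φ Z) ≤ k → FixpointRun (Φ Z) (1 + k)
    fixpoint-run′ k {Z} i μ≤k with Φ (Φ Z) ≟ˢ Φ Z
    ... | yes eq = Φ (Φ Z) , _ , fixpoint-exit eq , cong Φ eq , pres i , m≤m+n _ _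
    ... | no neq with k | ≤-trans (μ-decreases i (W⊆φ Z) (map₂ proj₁ ∘ ∈φ⁻) neq) μ≤k
    ...   | suc k | lt with R , t , run , eq , j , t≤ ← fixpoint-run′ k (pres i) (≤-pred lt) =
      R , _ , fixpoint-next neq run , eq , j , +-monoʳ-≤ (iterationCost κ) t≤

    fixpoint-run : ∀ {Z} → I Z → FixpointRun Z (2 + ∣ S ∣)
    fixpoint-run {Z} i with Φ Z ≟ˢ Z
    ... | yes eq = Φ Z , _ , fixpoint-exit eq , cong Φ eq , pres i , m≤m+n _ _
    ... | no neq with R , t , run , eq , j , t≤ ← fixpoint-run′ ∣ S ∣ (pres i) (μ≤∣S∣ (Φ Z)) =
      R , _ , fixpoint-next neq run , eq , j , +-monoʳ-≤ (iterationCost κ) t≤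

  module _ {P : Subset n} (solved : Solved G P W)
           (S-fresh : ∀ {v} → v ∈ S → v ∉ P)
           (closed : ∀ {v w} → v ∈ S → w ∈ E v → w ∈ P ⊎ w ∈ S) where
    open Solved solved

    private
      X : Subset n
      X = P ∩ ∁ W

      ∈X⁺ : ∀ {v} → v ∈ P → v ∉ W → v ∈ X
      ∈X⁺ v∈P v∉W = x∈p∩q⁺ (v∈P , x∉p⇒x∈∁p v∉W)

      ∈X⁻ : ∀ {v} → v ∈ X → v ∈ P × v ∉ W
      ∈X⁻ v∈ = let p , w = x∈p∩q⁻ P (∁ W) v∈ in p , x∈∁p⇒x∉p w

      ∈P∪S∖⁺ : ∀ {R v} → v ∈ P ⊎ v ∈ S → v ∉ W → v ∉ R → v ∈ (P ∪ S) ∩ ∁ (W ∪ R)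
      ∈P∪S∖⁺ {R} v∈ v∉W v∉R = x∈p∩q⁺ (x∈p∪q⁺ v∈ , x∉p⇒x∈∁p ([ v∉W , v∉R ]′ ∘ x∈p∪q⁻ W R))

      ∈P∪S∖⁻ : ∀ {R v} → v ∈ (P ∪ S) ∩ ∁ (W ∪ R) → (v ∈ P ⊎ v ∈ S) × v ∉ W × v ∉ R
      ∈P∪S∖⁻ {R} v∈ with a , b ← x∈p∩q⁻ (P ∪ S) (∁ (W ∪ R)) v∈ =
        x∈p∪q⁻ P S a , x∈∁p⇒x∉p b ∘ p⊆p∪q R , x∈∁p⇒x∉p b ∘ q⊆p∪q W R

      W∪R⊆P∪S : ∀ {R} → Φ R ≡ R → W ∪ R ⊆ P ∪ S
      W∪R⊆P∪S {R} eq v∈ with x∈p∪q⁻ W R v∈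
      ... | inj₁ v∈W = p⊆p∪q S (W⊆P v∈W)
      ... | inj₂ v∈R with ∈φ⁻ (subst (_ ∈_) (sym eq) v∈R)
      ...   | inj₁ v∈W       = p⊆p∪q S (W⊆P v∈W)
      ...   | inj₂ (v∈S , _) = q⊆p∪q P S v∈S

      X⊆P∪S∖ : ∀ {R} → Φ R ≡ R → X ⊆ (P ∪ S) ∩ ∁ (W ∪ R)
      X⊆P∪S∖ {R} eq v∈ with v∈P , v∉W ← ∈X⁻ v∈ = ∈P∪S∖⁺ (inj₁ v∈P) v∉W λ v∈R →
        [ v∉W , (λ (v∈S , _) → S-fresh v∈S v∈P) ]′ (∈φ⁻ (subst (_ ∈_) (sym eq) v∈R))

    -- Each round is an attractor step: new nodes lie in `CPreₛ G Z` and extend the system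
    -- certificate. At the fixpoint the environment can stay outside `R`, and `S` has no node of
    -- `F`, so what is left of `S` extends its certificate at once.
    Reach-run : Empty (S ∩ F) → ∃[ R ] ∃[ t ] Reach κ G S W R t
                × Solved G (P ∪ S) (W ∪ R) × t ≤ fixpointCost κ ∣ S ∣
    Reach-run S-rejecting =
      let R , t , run , eq , (_ , c) , t≤ = fixpoint-run I μ pres (λ Z → ∣p∩q∣≤∣p∣ S (∁ Z)) dec
            ((λ v∈ → contradiction v∈ ∉⊥)
            , extend G sysCert (p⊆p∪q ⊥) λ v∈ v∉ → contradiction v∈
                ([ v∉ , ∉⊥ ]′ ∘ x∈p∪q⁻ W ⊥))
      in R , t , run , record
        { W⊆P     = W∪R⊆P∪S eq
        ; sysCert = c
        ; envCert = extend G envCert (X⊆P∪S∖ eq) (trap eq)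
        } , t≤
      where
      I : Subset n → Set
      I Z = Z ⊆ Φ Z × SystemCertificate G (W ∪ Z)

      μ : Subset n → ℕ
      μ Z = ∣ S ∩ ∁ Z ∣

      pres : ∀ {Z} → I Z → I (Φ Z)
      pres {Z} (inc , c) = φ-mono κ G S W inc , extend G c
        (λ v∈ → x∈p∪q⁺ (map₂ inc (x∈p∪q⁻ W Z v∈)))
        λ v∈ v∉ → let v∈C = attracted v∈ (v∉ ∘ p⊆p∪q Z) in
          Forces-map G (λ _ w∈Z → q⊆p∪q W (Φ Z) (inc w∈Z) , λ _ → q⊆p∪q W Z w∈Z) (∈CPreₛ⁻ G v∈C)
        where
        attracted : ∀ {v} → v ∈ W ∪ Φ Z → v ∉ W → v ∈ CPreₛ G Z
        attracted v∈ v∉W with x∈p∪q⁻ W (Φ Z) v∈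
        ... | inj₁ v∈W = contradiction v∈W v∉W
        ... | inj₂ v∈Φ = [ (λ v∈W → contradiction v∈W v∉W) , proj₂ ]′ (∈φ⁻ v∈Φ)

      dec : ∀ {Z} → I Z → W ⊆ Z → (∀ {v} → v ∈ Z → v ∈ W ⊎ v ∈ S) → Φ Z ≢ Z → μ (Φ Z) < μ Z
      dec {Z} (inc , _) W⊆Z _ neq with v , v∈Φ , v∉Z ← ⊆∧≢⇒∃ inc (neq ∘ sym) = p⊂q⇒∣p∣<∣q∣
        ( (λ u∈ → let a , b = x∈p∩q⁻ S (∁ (Φ Z)) u∈ in
             x∈p∩q⁺ (a , x∉p⇒x∈∁p (x∈∁p⇒x∉p b ∘ inc)))
        , v
        , x∈p∩q⁺ ( [ (λ v∈W → contradiction (W⊆Z v∈W) v∉Z) , proj₁ ]′ (∈φ⁻ v∈Φ) , x∉p⇒x∈∁p v∉Z)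
        , λ v∈ → x∈∁p⇒x∉p (proj₂ (x∈p∩q⁻ S (∁ (Φ Z)) v∈)) v∈Φ)

      trap : ∀ {R v} → Φ R ≡ R → v ∈ (P ∪ S) ∩ ∁ (W ∪ R) → v ∉ X →
             Forces G Vₑ (λ w → w ∈ (P ∪ S) ∩ ∁ (W ∪ R) × (v ∈ F → w ∈ X)) v
      trap {R} eq v∈ v∉X with ∈P∪S∖⁻ v∈
      ... | inj₁ v∈P , v∉W , _ = contradiction (∈X⁺ v∈P v∉W) v∉X
      ... | inj₂ v∈S , _ , v∉R = Forces-map G
        -- Avoiding `R` also avoids `W`, because `W ⊆ Φ R` and `Φ R ≡ R`.
        (λ {w} e w∉R → ∈P∪S∖⁺ (closed v∈S e) (λ w∈W → w∉R (subst (w ∈_) eq (W⊆φ R w∈W))) w∉R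
                     , λ v∈F → contradiction (_ , x∈p∩q⁺ (v∈S , v∈F)) S-rejecting)
        (∉CPreₛ⁻ G (∉φ⇒∉CPreₛ v∈S (v∉R ∘ subst (_ ∈_) eq)))

    -- Dually, from the nodes of `S` dropped in a round the environment can move out of `Z`, so they
    -- extend its certificate. At the fixpoint the system can stay in `R`, whose nodes outside `W`
    -- lie in `S ⊆ F` and are not bad.
    Safe-run : S ⊆ F → ∃[ R ] ∃[ t ] Safe κ G S W R t
               × Solved G (P ∪ S) (W ∪ R) × t ≤ fixpointCost κ ∣ S ∣
    Safe-run S⊆F =
      let R , t , run , eq , (_ , W⊆R , c) , t≤ = fixpoint-run I μ pres (∣p∩q∣≤∣p∣ S) dec
            ((λ _ → ∈⊤) , (λ _ → ∈⊤)
            , extend G envCert (p⊆p∪q (S ∩ ∁ ⊤)) λ v∈ v∉ → contradiction v∈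
                ([ v∉ , (λ v∈ → x∈∁p⇒x∉p (proj₂ (x∈p∩q⁻ S (∁ ⊤) v∈)) ∈⊤) ]′
                  ∘ x∈p∪q⁻ X (S ∩ ∁ ⊤)))
      in R , t , run , record
        { W⊆P     = W∪R⊆P∪S eq
        ; sysCert = extend G sysCert (p⊆p∪q R) (trap eq)
        -- `covered` shows that no node is new here; `extend` only transfers the certificate to the
        -- set that `Solved` names.
        ; envCert = extend G c
            (λ v∈ → [ X⊆P∪S∖ eq
                    , (λ v∈ → let a , b = x∈p∩q⁻ S (∁ R) v∈ in
                        ∈P∪S∖⁺ (inj₂ a) (S-fresh a ∘ W⊆P) (x∈∁p⇒x∉p b)) ]′ (x∈p∪q⁻ X (S ∩ ∁ R) v∈))
            (λ v∈ v∉ → contradiction (covered v∈) v∉)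
        } , t≤
      where
      -- The complement of `Z` is cut down to `S`: the first round from `⊤` also discards the nodes
      -- outside `W` and `S`, some of which may be undecided. `W ⊆ Z` puts every node of `P` outside
      -- `Z` into `X`.
      I : Subset n → Set
      I Z = Φ Z ⊆ Z × W ⊆ Z × EnvironmentCertificate G (X ∪ (S ∩ ∁ Z))

      μ : Subset n → ℕ
      μ Z = ∣ S ∩ Z ∣

      covered : ∀ {R v} → v ∈ (P ∪ S) ∩ ∁ (W ∪ R) → v ∈ X ∪ (S ∩ ∁ R)
      covered v∈ with ∈P∪S∖⁻ v∈
      ... | inj₁ v∈P , v∉W , _ = x∈p∪q⁺ (inj₁ (∈X⁺ v∈P v∉W))
      ... | inj₂ v∈S , _ , v∉R = x∈p∪q⁺ (inj₂ (x∈p∩q⁺ (v∈S , x∉p⇒x∈∁p v∉R)))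

      pres : ∀ {Z} → I Z → I (Φ Z)
      pres {Z} (dec , W⊆Z , c) = φ-mono κ G S W dec , W⊆φ Z , extend G c grow repelled
        where
        grow : X ∪ (S ∩ ∁ Z) ⊆ X ∪ (S ∩ ∁ (Φ Z))
        grow v∈ with x∈p∪q⁻ X (S ∩ ∁ Z) v∈
        ... | inj₁ v∈X = x∈p∪q⁺ (inj₁ v∈X)
        ... | inj₂ v∈∩ with v∈S , v∉Z ← x∈p∩q⁻ S (∁ Z) v∈∩ =
          x∈p∪q⁺ (inj₂ (x∈p∩q⁺ (v∈S , x∉p⇒x∈∁p (x∈∁p⇒x∉p v∉Z ∘ dec))))

        outside-Z : ∀ {w} → w ∈ P ⊎ w ∈ S → w ∉ Z → w ∈ X ∪ (S ∩ ∁ Z)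
        outside-Z (inj₁ w∈P) w∉Z = x∈p∪q⁺ (inj₁ (∈X⁺ w∈P (w∉Z ∘ W⊆Z)))
        outside-Z (inj₂ w∈S) w∉Z = x∈p∪q⁺ (inj₂ (x∈p∩q⁺ (w∈S , x∉p⇒x∈∁p w∉Z)))

        repelled : ∀ {v} → v ∈ X ∪ (S ∩ ∁ (Φ Z)) → v ∉ X ∪ (S ∩ ∁ Z) →
          Forces G Vₑ (λ w → w ∈ X ∪ (S ∩ ∁ (Φ Z)) × (v ∈ F → w ∈ X ∪ (S ∩ ∁ Z))) v
        repelled v∈ v∉ with x∈p∪q⁻ X (S ∩ ∁ (Φ Z)) v∈
        ... | inj₁ v∈X = contradiction (x∈p∪q⁺ (inj₁ v∈X)) v∉
        ... | inj₂ v∈∩ with v∈S , v∈∁ ← x∈p∩q⁻ S (∁ (Φ Z)) v∈∩ = Forces-map G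
          (λ e w∉Z → let w∈ = outside-Z (closed v∈S e) w∉Z in grow w∈ , λ _ → w∈)
          (∉CPreₛ⁻ G (∉φ⇒∉CPreₛ v∈S (x∈∁p⇒x∉p v∈∁)))

      dec : ∀ {Z} → I Z → W ⊆ Z → (∀ {v} → v ∈ Z → v ∈ W ⊎ v ∈ S) → Φ Z ≢ Z → μ (Φ Z) < μ Z
      dec {Z} (dec , _) _ Z⊆ neq with v , v∈Z , v∉Φ ← ⊆∧≢⇒∃ dec neq = p⊂q⇒∣p∣<∣q∣
        ( (λ u∈ → let a , b = x∈p∩q⁻ S (Φ Z) u∈ in x∈p∩q⁺ (a , dec b))
        , v
        , x∈p∩q⁺ ([ (λ v∈W → contradiction (W⊆φ Z v∈W) v∉Φ) , id ]′ (Z⊆ v∈Z) , v∈Z)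
        , λ v∈ → v∉Φ (proj₂ (x∈p∩q⁻ S (Φ Z) v∈)))

      trap : ∀ {R v} → Φ R ≡ R → v ∈ W ∪ R → v ∉ W →
             Forces G Vₛ (λ w → w ∈ W ∪ R × (v ∈ ∁ F → w ∈ W)) v
      trap {R} eq v∈ v∉W with x∈p∪q⁻ W R v∈
      ... | inj₁ v∈W = contradiction v∈W v∉W
      ... | inj₂ v∈R with ∈φ⁻ (subst (_ ∈_) (sym eq) v∈R)
      ...   | inj₁ v∈W = contradiction v∈W v∉W
      ...   | inj₂ (v∈S , v∈C) = Forces-map G
        (λ _ w∈R → q⊆p∪q W R w∈R , λ v∉F → contradiction (S⊆F v∈S) (x∈∁p⇒x∉p v∉F))
        (∈CPreₛ⁻ G v∈C)

    process-run : S ⊆ F ⊎ Empty (S ∩ F) →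
      ∃[ W′ ] ∃[ t ] process κ G S W W′ t × Solved G (P ∪ S) W′
                   × t ≤ κ + (fixpointCost κ ∣ S ∣ + 1)
    process-run weak with S ⊆? F
    ... | yes S⊆F with R , t , run , solved′ , t≤ ← Safe-run S⊆F =
      W ∪ R , _ , (true , _ , _ , (refl , refl) , (R , t , 1 , run , (refl , refl) , refl) , refl)
      , solved′ , +-monoʳ-≤ κ (+-monoˡ-≤ 1 t≤)
    ... | no ¬S⊆F with R , t , run , solved′ , t≤ ←
                         Reach-run ([ (λ S⊆F → contradiction S⊆F ¬S⊆F) , id ]′ weak) =
      W ∪ R , _ , (false , _ , _ , (refl , refl) , (R , t , 1 , run , (refl , refl) , refl) , refl)
      , solved′ , +-monoʳ-≤ κ (+-monoˡ-≤ 1 t≤)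

-- Processing the SCCs bottom-up

∈-∖⁺ : ∀ (L M : List (Subset n)) {S} → S ∈ˡ L → ¬ S ∈ˡ M → S ∈ˡ L ∖ M
∈-∖⁺ L M = ∈-filter⁺ λ S → ¬? (S ∈ˡ? M)

∈-∖⁻ : ∀ (L M : List (Subset n)) {S} → S ∈ˡ L ∖ M → S ∈ˡ L × ¬ S ∈ˡ M
∈-∖⁻ L M = ∈-filter⁻ (λ S → ¬? (S ∈ˡ? M)) {xs = L}

length-∖ : ∀ (L M : List (Subset n)) {S} → S ∈ˡ L → S ∈ˡ M → length (L ∖ M) < length L
length-∖ L M S∈L S∈M = filter-notAll (λ S → ¬? (S ∈ˡ? M)) L (lose S∈L λ S∉M → S∉M S∈M)

Unique-∖ : ∀ (L M : List (Subset n)) → Unique L → Unique (L ∖ M)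
Unique-∖ L M = Unique.filter⁺ λ S → ¬? (S ∈ˡ? M)

-- The two `κ` pay for extracting an SCC and testing `S ⊆ F`, the 1 for the union with `W`, and the
-- 3 for the two extra iterations and that of the first node. Each further node adds one iteration.
-- As an SCC is nonempty, its nodes can bear this overhead.
costPerNode : ℕ → ℕ
costPerNode κ = κ + κ + 1 + 3 * iterationCost κ

processCost≤ : ∀ κ {s} → 0 < s → κ + (κ + (fixpointCost κ s + 1)) ≤ costPerNode κ * s
processCost≤ κ {suc s} _ = begin
  κ + (κ + ((3 + s) * u + 1))   ≡⟨ regroup κ s u ⟩
  c + s * u                     ≤⟨ +-monoʳ-≤ c (*-monoʳ-≤ s u≤c) ⟩
  c + s * c                     ≡⟨ *-comm (suc s) c ⟩
  c * suc s                     ∎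
  where
  open ≤-Reasoning
  u = iterationCost κ
  c = costPerNode κ

  regroup : ∀ κ s u → κ + (κ + ((3 + s) * u + 1)) ≡ (κ + κ + 1 + 3 * u) + s * u
  regroup = solve-∀

  u≤c : u ≤ c
  u≤c = ≤-trans (m≤m+n u (2 * u)) (m≤n+m (3 * u) (κ + κ + 1))

module _ (κ : ℕ) {n : ℕ} (G : Game n) (weak : IsWeak G) where
  open Game G

  private
    c : ℕ
    c = costPerNode κ

  record Worklist (L : List (Subset n)) (P : Subset n) : Set where
    field
      unique   : Unique L
      isSCC    : ∀ {S} → S ∈ˡ L → IsSCC _⟶_ S
      disjoint : ∀ {S v} → S ∈ˡ L → v ∈ S → v ∉ P

  -- Kept apart from `Worklist` because it is available for a batch of bottom SCCs, not for all SCCs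
  -- that remain.
  Closed : List (Subset n) → Subset n → Set
  Closed L P = ∀ {S v w} → S ∈ˡ L → v ∈ S → w ∈ E v → w ∈ P ⊎ w ∈ S

  -- Every node put into P pays for c operations, so the potential c * ∣ P ∣
  -- bounds the cost.
  processAll-run : ∀ L {P W} → Solved G P W → Worklist L P → Closed L P →
    ∃[ P′ ] ∃[ W′ ] ∃[ t ] forEach L W (process κ G) W′ t × Solved G P′ W′
    × (∀ {v} → v ∈ P′ ⇔ (v ∈ P ⊎ Any (v ∈_) L))
    × κ * length L + t + c * ∣ P ∣ ≤ c * ∣ P′ ∣
  processAll-run [] {P} {W} solved _ _ =
    P , W , 0 , (refl , refl) , solved , mk⇔ inj₁ [ id , (λ ()) ]′
    , ≤-reflexive (cong (λ k → k + 0 + c * ∣ P ∣) (*-zeroʳ κ))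
  processAll-run (S ∷ L) {P} {W} solved
    record { unique = S≢ ∷ unique ; isSCC = isSCC ; disjoint = disjoint } closed
    with W₁ , t₁ , run₁ , solved₁ , t₁≤ ←
           process-run κ G S W solved (disjoint (here refl)) (closed (here refl))
             (IsWeak⇒SCC weak (isSCC (here refl)))
    = let P′ , W′ , t₂ , run₂ , solved₂ , P′⇔ , t₂≤ = processAll-run L solved₁ (record
            { unique   = unique
            ; isSCC    = λ S′∈ → isSCC (there S′∈)
            -- A node shared with `S` would make the two SCCs equal, against the uniqueness of list
            -- entries.
            ; disjoint = λ S′∈ v∈S′ v∈P∪S → [ disjoint (there S′∈) v∈S′
                , (λ v∈S → All.lookup S≢ S′∈
                    (SCC-unique (isSCC (here refl)) (isSCC (there S′∈)) v∈S v∈S′)) ]′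
                (x∈p∪q⁻ P S v∈P∪S)
            }) (λ S′∈ v∈S′ e → map₁ (p⊆p∪q S) (closed (there S′∈) v∈S′ e))
      in P′ , W′ , _ , (_ , _ , _ , run₁ , run₂ , refl) , solved₂
       , mk⇔ (λ v∈ → [ (λ v∈P∪S → map₂ here (x∈p∪q⁻ P S v∈P∪S)) , inj₂ ∘ there ]′
                       (Equivalence.to P′⇔ v∈))
             (λ v∈ → Equivalence.from P′⇔ (split v∈))
       , cost t₂≤
    where
    split : ∀ {v} → v ∈ P ⊎ Any (v ∈_) (S ∷ L) → v ∈ P ∪ S ⊎ Any (v ∈_) L
    split (inj₁ v∈P)         = inj₁ (p⊆p∪q S v∈P)
    split (inj₂ (here v∈S))  = inj₁ (q⊆p∪q P S v∈S)
    split (inj₂ (there any)) = inj₂ any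

    0<∣S∣ : 0 < ∣ S ∣
    0<∣S∣ = 0<∣p∣ (proj₂ (SCC-nonempty (IsWeak⇒node weak) (isSCC (here refl))))

    ∣P∪S∣ : ∣ P ∪ S ∣ ≡ ∣ P ∣ + ∣ S ∣
    ∣P∪S∣ = ∣p∪q∣≡∣p∣+∣q∣ P S λ v∈P v∈S → disjoint (here refl) v∈S v∈P

    cost : ∀ {t₂ p′} → κ * length L + t₂ + c * ∣ P ∪ S ∣ ≤ c * p′ →
           κ * suc (length L) + (t₁ + t₂) + c * ∣ P ∣ ≤ c * p′
    cost {t₂} {p′} t₂≤ = begin
      κ * suc (length L) + (t₁ + t₂) + c * ∣ P ∣
        ≡⟨ regroup κ (length L) t₁ t₂ (c * ∣ P ∣) ⟩
      κ + t₁ + (κ * length L + t₂ + c * ∣ P ∣)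
        ≤⟨ +-monoˡ-≤ _ (≤-trans (+-monoʳ-≤ κ t₁≤) (processCost≤ κ 0<∣S∣)) ⟩
      c * ∣ S ∣ + (κ * length L + t₂ + c * ∣ P ∣)
        ≡⟨ collect c (∣ S ∣) (κ * length L + t₂) (∣ P ∣) ⟩
      κ * length L + t₂ + c * (∣ P ∣ + ∣ S ∣)
        ≡⟨ cong (λ k → κ * length L + t₂ + c * k) (sym ∣P∪S∣) ⟩
      κ * length L + t₂ + c * ∣ P ∪ S ∣
        ≤⟨ t₂≤ ⟩
      c * p′ ∎
      where
      open ≤-Reasoning

      regroup : ∀ κ l t₁ t₂ p → κ * suc l + (t₁ + t₂) + p ≡ κ + t₁ + (κ * l + t₂ + p)
      regroup = solve-∀

      collect : ∀ c s x p → c * s + (x + c * p) ≡ x + c * (p + s)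
      collect = solve-∀

  -- `k` is recursion fuel: a bottom SCC exists in every nonempty list, so each round shortens it.
  -- As `P` and `L` together cover all nodes, `P` is everything once `L` is empty; the potential
  -- telescopes to at most `c * n`.
  solve-run : ∀ k L → length L ≤ k → ∀ {P W} → Solved G P W → Worklist L P →
    (∀ v → v ∈ P ⊎ Any (v ∈_) L) →
    ∃[ P′ ] ∃[ W′ ] ∃[ t ] Loop (round κ G) (L , W) W′ t × Solved G P′ W′
    × (∀ v → v ∈ P′) × t + c * ∣ P ∣ ≤ c * n
  solve-run k [] _ {P} {W} solved _ cover =
    P , W , 0 , exit (refl , refl) , solved , (λ v → [ id , (λ ()) ]′ (cover v)) , *-monoʳ-≤ c (∣p∣≤n P)
  solve-run (suc k) L@(S₀ ∷ L₀) len {P} {W} solved wl cover =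
    let P₁ , W₁ , t₁ , run₁ , solved₁ , P₁⇔ , t₁≤ = processAll-run B solved worklistᴮ closed
        M , M∈L , bottom = ∃-bottom _⟶?_ S₀ L₀ isSCC
        P₂ , W₂ , t₂ , run₂ , solved₂ , all , t₂≤ =
          solve-run k (L ∖ B)
            (≤-pred (≤-trans (length-∖ L B M∈L (∈-filter⁺ (bottom? _⟶?_ L) M∈L bottom)) len))
            solved₁
            (record
              { unique   = Unique-∖ L B unique
              ; isSCC    = isSCC ∘ proj₁ ∘ ∈-∖⁻ L B
              ; disjoint = λ S∈ v∈S v∈P₁ → disjoint′ (∈-∖⁻ L B S∈) v∈S (Equivalence.to P₁⇔ v∈P₁)
              })
            (λ v → cover′ (Equivalence.from P₁⇔) (cover v))
    in P₂ , W₂ , _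
     , next (B , κ * length B , t₁ + 0 , (refl , refl)
            , (W₁ , t₁ , 0 , run₁ , (refl , refl) , refl) , refl) run₂
     , solved₂ , all
     , ≤-trans (≤-reflexive (regroup (κ * length B) t₁ t₂ (c * ∣ P ∣)))
               (≤-trans (+-monoʳ-≤ t₂ t₁≤) t₂≤)
    where
    open Worklist wl

    B : List (Subset n)
    B = bottomSCCs G L

    B⊆L : ∀ {S} → S ∈ˡ B → S ∈ˡ L × Bottom _⟶_ L S
    B⊆L = ∈-filter⁻ (bottom? _⟶?_ L) {xs = L}

    worklistᴮ : Worklist B P
    worklistᴮ = record
      { unique   = Unique.filter⁺ (bottom? _⟶?_ L) unique
      ; isSCC    = isSCC ∘ proj₁ ∘ B⊆L
      ; disjoint = disjoint ∘ proj₁ ∘ B⊆L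
      }

    closed : Closed B P
    closed {S} {v} {w} S∈B v∈S e with cover w
    ... | inj₁ w∈P = inj₁ w∈P
    ... | inj₂ any with S′ , S′∈L , w∈S′ ← find any =
      -- The edge makes `S` reach `S′`, and `S` is bottom in `L`, so `S′` is `S`.
      inj₂ (subst (w ∈_) (All.lookup (proj₂ (B⊆L S∈B)) S′∈L (v , w , v∈S , w∈S′ , e ◅ ε)) w∈S′)

    disjoint′ : ∀ {S v} → S ∈ˡ L × ¬ S ∈ˡ B → v ∈ S → ¬ (v ∈ P ⊎ Any (v ∈_) B)
    disjoint′ (S∈L , _)   v∈S (inj₁ v∈P) = disjoint S∈L v∈S v∈P
    disjoint′ (S∈L , S∉B) v∈S (inj₂ any) with S′ , S′∈B , v∈S′ ← find any =
      S∉B (subst (_∈ˡ B) (SCC-unique (isSCC (proj₁ (B⊆L S′∈B))) (isSCC S∈L) v∈S′ v∈S) S′∈B)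

    cover′ : ∀ {P₁ v} → (v ∈ P ⊎ Any (v ∈_) B → v ∈ P₁) →
             v ∈ P ⊎ Any (v ∈_) L → v ∈ P₁ ⊎ Any (v ∈_) (L ∖ B)
    cover′ f (inj₁ v∈P) = inj₁ (f (inj₁ v∈P))
    cover′ f (inj₂ any) with S , S∈L , v∈S ← find any with S ∈ˡ? B
    ... | yes S∈B = inj₁ (f (inj₂ (lose S∈B v∈S)))
    ... | no  S∉B = inj₂ (lose (∈-∖⁺ L B S∈L S∉B) v∈S)

    regroup : ∀ b t₁ t₂ p → b + (t₁ + 0) + t₂ + p ≡ t₂ + (b + t₁ + p)
    regroup = solve-∀

lemma8 : ∀ (κ : ℕ) → ∃[ c ]
    (∀ (n : ℕ) (G : Game n) → IsWeak G →
    ∀ (SCCs : List (Subset n)) → Unique SCCs →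
    (∀ S → S ∈ˡ SCCs ⇔ IsSCC (Game._⟶_ G) S) →
    ∃[ W ] ∃[ t ]
    SolveWeakSCC κ G SCCs W t
    × t ≤ c * n
    × (∀ v → v ∈ W ⇔ WonBySystem G v)
    × ∃[ σ ] (∀ v → v ∈ W → Wins G (memoryless G σ) v))
lemma8 κ = costPerNode κ , λ n G weak SCCs unique SCCs⇔ →
  let open Game G
      P , W , t , run , solved , all , t≤ = solve-run κ G weak (length SCCs) SCCs ≤-refl
        (record
          { W⊆P     = ⊆-min ⊥
          ; sysCert = ⊥-certificate G λ (_ , v∈) → ∉⊥ v∈
          ; envCert = ⊥-certificate G λ (_ , v∈) → ∉⊥ (proj₁ (x∈p∩q⁻ ⊥ (∁ ⊥) v∈))
          })
        (record
          { unique   = unique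
          ; isSCC    = Equivalence.to (SCCs⇔ _)
          ; disjoint = λ _ _ → ∉⊥
          })
        (λ v → inj₂ (lose (Equivalence.from (SCCs⇔ _) (SCC-of-isSCC _⟶?_ v)) (SCC-of⁺ _⟶?_ ε ε)))
      open Solved solved
  in W , t , run , ≤-trans (m≤m+n t _) t≤
   , (λ v → mk⇔
       (λ v∈W → memoryless G (strategy G sysCert) , system-wins G sysCert v∈W)
       -- All nodes are processed, so a node outside `W` falls under the environment certificate.
       (λ won → decidable-stable (v ∈? W) λ v∉W →
         environment-wins G envCert (x∈p∩q⁺ (all v , x∉p⇒x∈∁p v∉W)) won))
   , strategy G sysCert , λ v → system-wins G sysCert
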